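{- Let $T$ be a (finite) tree. Then the $3$-path free complex of $T$ is vertex decomposable.
   Context: Graphs are finite and simple. For a graph $G$ and $A\subseteq V(G)$, $G[A]$ denotes the induced subgraph on $A$. A tree is a connected graph in which there is a unique path between every pair of distinct vertices. The $t$-path free complex of a graph $G$ is the simplicial complex whose faces are the subsets $A\subseteq V(G)$ inducing no path on $t$ vertices, i.e. such that $G[A]$ contains no path on $t$ vertices, where a path is a sequence of distinct vertices with consecutive ones adjacent. A simplicial complex $\Delta$ on a finite vertex set is a collection of subsets (faces) closed under taking subsets; facets are the inclusion-maximal faces. The empty complex $\{\emptyset\}$ has only the empty face, and the void complex $\emptyset$ has no faces. A simplex is a complex with exactly one facet. For a vertex $v$ of $\Delta$: $\mathrm{lk}_\Delta(v)=\{F\in\Delta : v\notin F,\ F\cup\{v\}\in\Delta\}$ and $\mathrm{del}_\Delta(v)=\{F\in\Delta : v\notin F\}$. $\Delta$ is vertex decomposable if either $\Delta$ is a simplex (including the cases $\emptyset$ and $\{\emptyset\}$), or there exists a vertex $v$ of $\Delta$ such that both $\mathrm{lk}_\Delta(v)$ and $\mathrm{del}_\Delta(v)$ are vertex decomposable and each facet of $\mathrm{del}_\Delta(v)$ is a facet of $\Delta$ (recursive definition; $\Delta$ is not required to be pure). -}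

module Defs where

open import Level using (0ℓ)
open import Data.Nat.Base using (ℕ)
open import Data.Fin.Base using (Fin)
open import Data.Fin.Subset using (Subset; _∈_; _∉_; _⊆_; _∪_; ⁅_⁆)
open import Data.Fin.Subset.Properties using (x∈p∪q⁻; x∈p∪q⁺)
open import Data.List.Base using (List; length; head; last)
open import Data.List.Relation.Unary.All as All using (All)
open import Data.List.Relation.Unary.Linked using (Linked)
open import Data.List.Relation.Unary.Unique.Propositional using (Unique)
open import Data.Maybe.Base using (just)
open import Data.Product using (_×_; _,_; ∃; ∃!)
open import Data.Sum.Base using (map₁)
open import Function.Base using (_∘_)
open import Relation.Binary.Core using (Rel)
open import Relation.Binary.Definitions using (Symmetric; Irreflexive; Decidable)
open import Relation.Binary.PropositionalEquality.Core using (_≡_; _≢_)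
open import Relation.Nullary.Negation.Core using (¬_)
open import Relation.Unary using (Pred)

-- Decidability of adjacency is automatic classically; it is what makes
-- the edge set a finite set constructively.
record Graph (n : ℕ) : Set₁ where
  field
    Adj    : Rel (Fin n) 0ℓ
    sym    : Symmetric Adj
    irrefl : Irreflexive _≡_ Adj
    adj?   : Decidable Adj

module _ {n : ℕ} (G : Graph n) where
  open Graph G

  IsPath : List (Fin n) → Set
  IsPath p = Unique p × Linked Adj p

  IsPathFromTo : Fin n → Fin n → List (Fin n) → Set
  IsPathFromTo u v p = IsPath p × head p ≡ just u × last p ≡ just v

  -- The paths of the induced subgraph G[A] are the paths of G all of
  -- whose vertices lie in A.
  IsPathIn : Subset n → List (Fin n) → Set
  IsPathIn A p = IsPath p × All (_∈ A) p

  Connected : Set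
  Connected = ∀ u v → ∃ (IsPathFromTo u v)

  record IsTree : Set where
    field
      connected  : Connected
      uniquePath : ∀ u v → u ≢ v → ∃! _≡_ (IsPathFromTo u v)

-- The void complex, with no faces at all, is allowed, and an element of
-- Fin n need not be a vertex of the complex.
record SimplicialComplex (n : ℕ) : Set₁ where
  field
    Face   : Pred (Subset n) 0ℓ
    closed : ∀ {A B} → A ⊆ B → Face B → Face A

open SimplicialComplex

module _ {n : ℕ} (Δ : SimplicialComplex n) where

  IsVertex : Fin n → Set
  IsVertex v = Face Δ ⁅ v ⁆

  IsFacet : Subset n → Set
  IsFacet F = Face Δ F × (∀ {H} → Face Δ H → F ⊆ H → F ≡ H)

  IsVoid : Set
  IsVoid = ∀ F → ¬ Face Δ F

  IsSimplex : Set
  IsSimplex = ∃! _≡_ IsFacet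

  link : Fin n → SimplicialComplex n
  link v .Face F = Face Δ F × v ∉ F × Face Δ (F ∪ ⁅ v ⁆)
  link v .closed A⊆B (fB , v∉B , fBv) =
    closed Δ A⊆B fB , v∉B ∘ A⊆B ,
    closed Δ (x∈p∪q⁺ ∘ map₁ A⊆B ∘ x∈p∪q⁻ _ _) fBv

  deletion : Fin n → SimplicialComplex n
  deletion v .Face F = Face Δ F × v ∉ F
  deletion v .closed A⊆B (fB , v∉B) = closed Δ A⊆B fB , v∉B ∘ A⊆B

-- The void complex has no facet, so it is listed apart from the simplices;
-- the complex {∅} has the single facet ∅ and is covered by `simplex`.
data VertexDecomposable {n : ℕ} (Δ : SimplicialComplex n) : Set where
  void      : IsVoid Δ → VertexDecomposable Δ
  simplex   : IsSimplex Δ → VertexDecomposable Δ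
  decompose : ∀ v → IsVertex Δ v →
              VertexDecomposable (link Δ v) →
              VertexDecomposable (deletion Δ v) →
              (∀ F → IsFacet (deletion Δ v) F → IsFacet Δ F) →
              VertexDecomposable Δ

pathFreeComplex : ∀ {n} → ℕ → Graph n → SimplicialComplex n
pathFreeComplex t G .Face A = ¬ (∃ λ p → length p ≡ t × IsPathIn G A p)
pathFreeComplex t G .closed A⊆B ¬p (p , len , isPath , p∈A) =
  ¬p (p , len , isPath , All.map A⊆B p∈A)

{-# OPTIONS --safe #-}

-- Links and deletions of the 3-path free complex of a forest are all of the
-- form { F ⊆ D : F ∪ S has no 3-path }, so one inducts on D for all such
-- complexes at once. If H = D ∪ S contains a 3-path, a path extended as far
-- as possible in H ends at a vertex y all of whose neighbours in H, except
-- possibly one neighbour z, are leaves of H; then y or z is a shedding vertex.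
module Submission where

open import Defs
open import Data.Nat.Base using (ℕ; suc)
open import Data.Empty using (⊥-elim)
open import Data.Fin.Base using (Fin; zero; suc; toℕ)
open import Data.Fin.Properties using (_≟_; any?)
open import Data.Fin.Subset as Subset
  using (Subset; _∈_; _∉_; _⊆_; _⊂_; _∪_; ⁅_⁆; _-_; ⊤)
open import Data.Fin.Subset.Induction using (⊂-wellFounded)
open import Data.Fin.Subset.Properties
  using (_∈?_; x∈p∪q⁻; x∈p∪q⁺; x∈⁅x⁆; x∈⁅y⁆⇒x≡y; p─q⊆p; x∈p∧x≢y⇒x∈p-y;
         x∈p⇒p-x⊂p; ⊆-antisym; ∈⊤; ∪-assoc; ∪-comm; ∪-identityʳ)
open import Data.List.Base using ([]; _∷_; last; take)
open import Data.List.Membership.Propositional renaming (_∈_ to _∈ˡ_; _∉_ to _∉ˡ_) using ()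
open import Data.List.Properties using (∷-injectiveˡ; ∷-injectiveʳ)
open import Data.List.Relation.Unary.All as All using ([]; _∷_)
open import Data.List.Relation.Unary.All.Properties using (¬Any⇒All¬)
open import Data.List.Relation.Unary.AllPairs using ([]; _∷_)
open import Data.List.Relation.Unary.Any using (here; there; index)
open import Data.List.Relation.Unary.Linked using (Linked; []; [-]; _∷_)
open import Data.List.Relation.Unary.Unique.Propositional.Properties using (take⁺)
open import Data.Maybe.Base using (just)
open import Data.Product using (_×_; _,_; ∃; ∃!; proj₁; proj₂)
open import Data.Sum.Base as Sum using (_⊎_; inj₁; inj₂; [_,_]′)
open import Data.Vec.Base using (_∷_; there)
open import Function.Base using (_∘_; id)
open import Induction.WellFounded using (Acc; acc)
open import Level using (0ℓ)
open import Relation.Binary.Core using (Rel)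
open import Relation.Binary.PropositionalEquality
  using (_≡_; _≢_; refl; sym; trans; cong; subst)
open import Relation.Nullary using (¬_; Dec; yes; no; contradiction; ¬?; _×-dec_)
open import Relation.Nullary.Decidable using (decidable-stable)
open import Relation.Unary using (Pred; _≐_)

open SimplicialComplex

-- Prefixes of lists.

module _ {a} {A : Set a} where

  linked-take : ∀ {ℓ} {R : Rel A ℓ} {xs} k → Linked R xs → Linked R (take k xs)
  linked-take 0             _        = []
  linked-take (suc k)       []       = []
  linked-take (suc k)       [-]      = linked-take-[-] k
    where
    linked-take-[-] : ∀ {ℓ} {R : Rel A ℓ} {x} k → Linked R (x ∷ take k [])
    linked-take-[-] 0       = [-]
    linked-take-[-] (suc k) = [-]
  linked-take 1             (r ∷ rs) = [-]
  linked-take (suc (suc k)) (r ∷ rs) = r ∷ linked-take (suc k) rs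

  -- Indices count from 0, so the prefix that still contains `x` is one longer than its index.
  last-take : ∀ {x : A} {xs} (i : x ∈ˡ xs) → last (take (suc (toℕ (index i))) xs) ≡ just x
  last-take (here refl)            = refl
  last-take (there {xs = _ ∷ _} i) = last-take i

-- Unions and removals of finite subsets.

module _ {n : ℕ} where

  ∪-swapʳ : ∀ (p q r : Subset n) → (p ∪ q) ∪ r ≡ (p ∪ r) ∪ q
  ∪-swapʳ p q r =
    trans (∪-assoc p q r) (trans (cong (p ∪_) (∪-comm q r)) (sym (∪-assoc p r q)))

  ∪-monoˡ : ∀ {p q : Subset n} (r : Subset n) → p ⊆ q → p ∪ r ⊆ q ∪ r
  ∪-monoˡ r p⊆q = x∈p∪q⁺ ∘ Sum.map₁ p⊆q ∘ x∈p∪q⁻ _ r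

  x∈p⇒⁅x⁆⊆p : ∀ {p : Subset n} {x} → x ∈ p → ⁅ x ⁆ ⊆ p
  x∈p⇒⁅x⁆⊆p x∈p i = subst (_∈ _) (sym (x∈⁅y⁆⇒x≡y _ i)) x∈p

  x∈p∪q∧x∉q⇒x∈p : ∀ {p q : Subset n} {x} → x ∈ p ∪ q → x ∉ q → x ∈ p
  x∈p∪q∧x∉q⇒x∈p x∈p∪q x∉q = [ id , (λ x∈q → contradiction x∈q x∉q) ]′ (x∈p∪q⁻ _ _ x∈p∪q)

  p⊆q∧x∉p⇒p⊆q-x : ∀ {p q : Subset n} {x} → p ⊆ q → x ∉ p → p ⊆ q - x
  p⊆q∧x∉p⇒p⊆q-x p⊆q x∉p i = x∈p∧x≢y⇒x∈p-y (p⊆q i) λ { refl → x∉p i }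

x∉p-x : ∀ {n} (p : Subset n) x → x ∉ p - x
x∉p-x (_ ∷ p) zero    ()
x∉p-x (_ ∷ p) (suc x) (there i) = x∉p-x p x i

-- Vertex sets without 3-paths.

module Forest {n : ℕ} (G : Graph n)
  (uniquePath : ∀ u v → u ≢ v → ∃! _≡_ (IsPathFromTo G u v)) where

  open Graph G renaming (sym to adj-sym)

  adj⇒≢ : ∀ {a b} → Adj a b → a ≢ b
  adj⇒≢ ab a≡b = irrefl a≡b ab

  -- A 3-path is a vertex with two distinct neighbours, so this says that the induced subgraph has
  -- maximum degree at most 1. Both edges point to the middle vertex `b`.
  PathFree : Subset n → Set
  PathFree P = ∀ {a b c} → a ∈ P → b ∈ P → c ∈ P → Adj a b → Adj c b → a ≡ c

  record Path₃ (P : Subset n) : Set where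
    constructor path₃
    field
      {a b c} : Fin n
      a∈P : a ∈ P
      b∈P : b ∈ P
      c∈P : c ∈ P
      a~b : Adj a b
      c~b : Adj c b
      a≢c : a ≢ c

  path₃? : ∀ P → Path₃ P ⊎ PathFree P
  path₃? P with any? (λ a → any? λ b → any? λ c →
    a ∈? P ×-dec b ∈? P ×-dec c ∈? P ×-dec adj? a b ×-dec adj? c b ×-dec ¬? (a ≟ c))
  ... | yes (_ , _ , _ , a∈P , b∈P , c∈P , a~b , c~b , a≢c) =
        inj₁ (path₃ a∈P b∈P c∈P a~b c~b a≢c)
  ... | no ¬path = inj₂ λ a∈P b∈P c∈P a~b c~b → decidable-stable (_ ≟ _) λ a≢c →
        ¬path (_ , _ , _ , a∈P , b∈P , c∈P , a~b , c~b , a≢c)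

  path₃-¬pathFree : ∀ {P} → Path₃ P → ¬ PathFree P
  path₃-¬pathFree (path₃ a∈P b∈P c∈P a~b c~b a≢c) free = a≢c (free a∈P b∈P c∈P a~b c~b)

  pathFree? : ∀ P → Dec (PathFree P)
  pathFree? P with path₃? P
  ... | inj₁ path = no (path₃-¬pathFree path)
  ... | inj₂ free = yes free

  pathFree-⊆ : ∀ {P Q} → P ⊆ Q → PathFree Q → PathFree P
  pathFree-⊆ P⊆Q free a b c = free (P⊆Q a) (P⊆Q b) (P⊆Q c)

  -- A new 3-path contains `w` either as its middle, excluded by `centre`, or as an end, excluded by
  -- `end`.
  pathFree-insert : ∀ {P w} → PathFree P →
    (∀ {a c} → a ∈ P → c ∈ P → Adj a w → Adj c w → a ≡ c) →
    (∀ {a b} → a ∈ P → b ∈ P → Adj b w → ¬ Adj a b) →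
    PathFree (P ∪ ⁅ w ⁆)
  pathFree-insert {P} {w} free centre end {a} {b} {c} a∈ b∈ c∈ a~b c~b =
    go (split a∈) (split b∈) (split c∈) a~b c~b
    where
    split : ∀ {u} → u ∈ P ∪ ⁅ w ⁆ → u ∈ P ⊎ u ≡ w
    split = Sum.map₂ (x∈⁅y⁆⇒x≡y w) ∘ x∈p∪q⁻ P _
    go : ∀ {a b c} → a ∈ P ⊎ a ≡ w → b ∈ P ⊎ b ≡ w → c ∈ P ⊎ c ≡ w →
         Adj a b → Adj c b → a ≡ c
    go (inj₁ a)    (inj₁ b)    (inj₁ c)    a~b c~b = free a b c a~b c~b
    go (inj₁ a)    (inj₁ b)    (inj₂ refl) a~b c~b = contradiction a~b (end a b (adj-sym c~b))
    go (inj₂ refl) (inj₁ b)    (inj₁ c)    a~b c~b = contradiction c~b (end c b (adj-sym a~b))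
    go (inj₂ refl) _           (inj₂ refl) _   _   = refl
    go (inj₁ a)    (inj₂ refl) (inj₁ c)    a~b c~b = centre a c a~b c~b
    go (inj₂ refl) (inj₂ refl) _           a~b _   = contradiction refl (adj⇒≢ a~b)
    go _           (inj₂ refl) (inj₂ refl) _   c~b = contradiction refl (adj⇒≢ c~b)

  -- Growing a path in a forest.

  -- A chord would give two paths from `y` to `c`: the edge itself and the prefix of the given path.
  -- Comparing second vertices forces `z` to equal `c`.
  path-no-chord : ∀ {y z c r} → IsPath G (y ∷ z ∷ r) → Adj y c → c ∉ˡ r
  path-no-chord {y} {z} {c} {r} (uniq@((_ ∷ y∉r) ∷ (z∉r ∷ _)) , linked) y~c c∈r =
    z≢c (∷-injectiveˡ (∷-injectiveʳ (trans (sym (unique₂ long)) (unique₂ short))))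
    where
    y≢c : y ≢ c
    y≢c = All.lookup y∉r c∈r
    z≢c : z ≢ c
    z≢c = All.lookup z∉r c∈r
    c∈p : c ∈ˡ y ∷ z ∷ r
    c∈p = there (there c∈r)
    k = suc (toℕ (index c∈p))
    unique₂ : ∀ {p} → IsPathFromTo G y c p → proj₁ (uniquePath y c y≢c) ≡ p
    unique₂ = proj₂ (proj₂ (uniquePath y c y≢c))
    long : IsPathFromTo G y c (take k (y ∷ z ∷ r))
    long = (take⁺ k uniq , linked-take k linked) , refl , last-take c∈p
    short : IsPathFromTo G y c (y ∷ c ∷ [])
    short = (((y≢c ∷ []) ∷ [] ∷ []) , y~c ∷ [-]) , refl , refl

  -- The situation where a growing path gets stuck at `y`, having arrived from `z`. By `leaf`, `x`
  -- is itself a leaf of `H` attached to `y`.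
  record PathEnd (H : Subset n) : Set where
    field
      {x y z} : Fin n
      x∈H  : x ∈ H
      y∈H  : y ∈ H
      z∈H  : z ∈ H
      x~y  : Adj x y
      z~y  : Adj z y
      x≢z  : x ≢ z
      leaf : ∀ {w u} → w ∈ H → Adj w y → w ≢ z → u ∈ H → Adj u w → u ≡ y

  -- x only witnesses a neighbour of y other than z: when the path grows at y
  -- by a neighbour w that is not a leaf, a further neighbour u of w takes over.
  extend : ∀ {H} U → Acc _⊂_ U → ∀ {x y z r} → IsPath G (y ∷ z ∷ r) →
           (∀ {v} → v ∉ˡ y ∷ z ∷ r → v ∈ U) →
           x ∈ H → y ∈ H → z ∈ H → Adj x y → x ≢ z → PathEnd H
  extend {H} U (acc rec) {x} {y} {z} {r} path@(uniq , z~y ∷ linked) unused x∈H y∈H z∈H x~y x≢z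
    with any? (λ w → any? λ u →
           w ∈? H ×-dec adj? w y ×-dec ¬? (w ≟ z) ×-dec u ∈? H ×-dec adj? u w ×-dec ¬? (u ≟ y))
  ... | no ¬longer = record
        { x∈H = x∈H ; y∈H = y∈H ; z∈H = z∈H ; x~y = x~y ; z~y = adj-sym z~y ; x≢z = x≢z
        ; leaf = λ w∈H w~y w≢z u∈H u~w → decidable-stable (_ ≟ _) λ u≢y →
            ¬longer (_ , _ , w∈H , w~y , w≢z , u∈H , u~w , u≢y)
        }
  ... | yes (w , u , w∈H , w~y , w≢z , u∈H , u~w , u≢y) =
        -- `U` contains every vertex off the path, so it shrinks as `w` joins the path.
        extend (U - w) (rec (x∈p⇒p-x⊂p (unused w∉)))
          (¬Any⇒All¬ _ w∉ ∷ uniq , w~y ∷ z~y ∷ linked)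
          (λ v∉ → x∈p∧x≢y⇒x∈p-y (unused (v∉ ∘ there)) (v∉ ∘ here))
          u∈H w∈H y∈H u~w u≢y
    where
    w∉ : w ∉ˡ y ∷ z ∷ r
    w∉ (here w≡y)         = adj⇒≢ w~y w≡y
    w∉ (there (here w≡z)) = w≢z w≡z
    w∉ (there (there w∈r)) = path-no-chord path (adj-sym w~y) w∈r

  pathEnd : ∀ {H} → Path₃ H → PathEnd H
  pathEnd (path₃ a∈H b∈H c∈H a~b c~b a≢c) =
    extend ⊤ (⊂-wellFounded ⊤)
      (((adj⇒≢ (adj-sym c~b) ∷ []) ∷ [] ∷ []) , adj-sym c~b ∷ [-])
      (λ _ → ∈⊤) a∈H b∈H c∈H a~b a≢c

  -- Finding a shedding vertex.

  -- The exchange property that makes v a shedding vertex, with K in the role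
  -- of F ∪ S for a face F of the deletion of v.
  Exchangeable : Subset n → Subset n → Fin n → Set
  Exchangeable H S v = ∀ {K} → S ⊆ K → K ⊆ H → v ∉ K → PathFree (K ∪ ⁅ v ⁆) →
    ∃ λ w → w ∈ H × w ∉ K × w ≢ v × PathFree (K ∪ ⁅ w ⁆)

  -- The hypothesis on `S` prevents `y` and `z` from both lying in `S`, since `x`, `y`, `z` would
  -- then form a 3-path inside `S` with `x` added.
  exchangeable : ∀ {H S} → (∀ {v} → v ∈ H → PathFree (S ∪ ⁅ v ⁆)) → Path₃ H →
    ∃ λ v → v ∈ H × v ∉ S × Exchangeable H S v
  exchangeable {H} {S} S∪v-free path = choose (y ∈? S) (z ∈? S) twoLeaves?
    where
    open PathEnd (pathEnd path)

    TwoLeaves = ∃ λ w → w ∈ H × Adj w y × w ≢ z × w ≢ x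

    twoLeaves? : Dec TwoLeaves
    twoLeaves? = any? λ w → w ∈? H ×-dec adj? w y ×-dec ¬? (w ≟ z) ×-dec ¬? (w ≟ x)

    old : ∀ {K : Subset n} {u v} → u ∈ K → u ∈ K ∪ ⁅ v ⁆
    old u∈K = x∈p∪q⁺ (inj₁ u∈K)

    new : ∀ (K : Subset n) {v} → v ∈ K ∪ ⁅ v ⁆
    new K = x∈p∪q⁺ {p = K} (inj₂ (x∈⁅x⁆ _))

    -- The only neighbour of `w` in `H` is `y`, so a new 3-path could only start at `w`, pass
    -- through `y` and end at another neighbour of `y` in `K`.
    insertLeaf : ∀ {K w} → K ⊆ H → PathFree K → w ∈ H → Adj w y → w ≢ z →
      (y ∈ K → ∀ {u} → u ∈ K → ¬ Adj u y) → PathFree (K ∪ ⁅ w ⁆)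
    insertLeaf K⊆H free w∈H w~y w≢z isolated = pathFree-insert free
      (λ a∈K c∈K a~w c~w → trans (only-y a∈K a~w) (sym (only-y c∈K c~w)))
      (λ a∈K b∈K b~w a~b → let b≡y = only-y b∈K b~w in
         isolated (subst (_∈ _) b≡y b∈K) a∈K (subst (Adj _) b≡y a~b))
      where
      only-y : ∀ {u} → u ∈ _ → Adj u _ → u ≡ y
      only-y u∈K u~w = leaf w∈H w~y w≢z (K⊆H u∈K) u~w

    -- With `z` added, `y` already has `z` as its one neighbour, so `y` is isolated in `K` and can
    -- take the leaf `x` instead.
    x-for-z : ∀ {K} → K ⊆ H → y ∈ K → z ∉ K → PathFree (K ∪ ⁅ z ⁆) →
      ∃ λ w → w ∈ H × w ∉ K × w ≢ z × PathFree (K ∪ ⁅ w ⁆)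
    x-for-z {K} K⊆H y∈K z∉K free =
      x , x∈H , (λ x∈K → x≢z (only-z x∈K x~y)) , x≢z ,
      insertLeaf K⊆H (pathFree-⊆ old free) x∈H x~y x≢z
        (λ _ u∈K u~y → z∉K (subst (_∈ K) (only-z u∈K u~y) u∈K))
      where
      only-z : ∀ {u} → u ∈ K → Adj u y → u ≡ z
      only-z u∈K u~y = free (old u∈K) (old y∈K) (new K) u~y z~y

    -- As `y` is outside `K`, the leaf `w` has no neighbour in `K` at all.
    leaf-for-y : ∀ {K w} → K ⊆ H → y ∉ K → PathFree (K ∪ ⁅ y ⁆) →
      w ∈ H → Adj w y → w ≢ z → w ∉ K →
      ∃ λ w → w ∈ H × w ∉ K × w ≢ y × PathFree (K ∪ ⁅ w ⁆)
    leaf-for-y K⊆H y∉K free w∈H w~y w≢z w∉K =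
      _ , w∈H , w∉K , adj⇒≢ w~y ,
      insertLeaf K⊆H (pathFree-⊆ old free) w∈H w~y w≢z (λ y∈K → contradiction y∈K y∉K)

    -- If y ∈ S, shed z; if z ∈ S or y has two leaves, shed y; otherwise shed z,
    -- since then x and y are adjacent to nothing else once z is deleted.
    choose : Dec (y ∈ S) → Dec (z ∈ S) → Dec TwoLeaves →
             ∃ λ v → v ∈ H × v ∉ S × Exchangeable H S v
    choose (yes y∈S) _ _ =
      z , z∈H , (λ z∈S → x≢z (S∪v-free x∈H (new S) (old y∈S) (old z∈S) x~y z~y)) ,
      λ S⊆K K⊆H → x-for-z K⊆H (S⊆K y∈S)
    choose (no y∉S) (yes z∈S) _ = y , y∈H , y∉S , λ {K} S⊆K K⊆H y∉K free →
      leaf-for-y K⊆H y∉K free x∈H x~y x≢z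
        λ x∈K → x≢z (free (old x∈K) (new K) (old (S⊆K z∈S)) x~y z~y)
    choose (no y∉S) (no _) (yes (w , w∈H , w~y , w≢z , w≢x)) =
      y , y∈H , y∉S , exchange
      where
      exchange : Exchangeable H S y
      exchange {K} S⊆K K⊆H y∉K free with x ∈? K
      ... | no x∉K  = leaf-for-y K⊆H y∉K free x∈H x~y x≢z x∉K
      ... | yes x∈K = leaf-for-y K⊆H y∉K free w∈H w~y w≢z
              λ w∈K → w≢x (free (old w∈K) (new K) (old x∈K) w~y x~y)
    choose (no _) (no z∉S) (no ¬twoLeaves) = z , z∈H , z∉S , exchange
      where
      nbr-y : ∀ {u} → u ∈ H → Adj u y → u ≢ z → u ≡ x
      nbr-y u∈H u~y u≢z = decidable-stable (_ ≟ _) λ u≢x →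
        ¬twoLeaves (_ , u∈H , u~y , u≢z , u≢x)
      exchange : Exchangeable H S z
      exchange {K} S⊆K K⊆H z∉K free with y ∈? K | x ∈? K
      ... | yes y∈K | _       = x-for-z K⊆H y∈K z∉K free
      ... | no y∉K  | no x∉K  = x , x∈H , x∉K , x≢z ,
              insertLeaf K⊆H (pathFree-⊆ old free) x∈H x~y x≢z (λ y∈K → contradiction y∈K y∉K)
      -- Adding `y` only creates an isolated edge between `x` and `y`.
      ... | no y∉K  | yes x∈K = y , y∈H , y∉K , adj⇒≢ (adj-sym z~y) ,
              pathFree-insert (pathFree-⊆ old free)
                (λ a∈K c∈K a~y c~y → trans (is-x a∈K a~y) (sym (is-x c∈K c~y)))
                (λ a∈K b∈K b~y a~b → y∉K (subst (_∈ K)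
                   (leaf x∈H x~y x≢z (K⊆H a∈K) (subst (Adj _) (is-x b∈K b~y) a~b)) a∈K))
        where
        is-x : ∀ {u} → u ∈ K → Adj u y → u ≡ x
        is-x u∈K u~y = nbr-y (K⊆H u∈K) u~y λ u≡z → z∉K (subst (_∈ K) u≡z u∈K)

  -- Complexes relative to a fixed vertex set.

  -- `D` holds the vertices still available and `S` those fixed by earlier links: a link moves a
  -- vertex from `D` to `S`, a deletion drops it from `D`.
  RelativeFace : Subset n → Subset n → Pred (Subset n) 0ℓ
  RelativeFace D S F = F ⊆ D × PathFree (F ∪ S)

  simplex-relative : ∀ {D S} Δ → Face Δ ≐ RelativeFace D S → PathFree (D ∪ S) → IsSimplex Δ
  simplex-relative {D} Δ (to , from) free =
    D , (D∈Δ , λ H∈Δ D⊆H → ⊆-antisym D⊆H (proj₁ (to H∈Δ))) ,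
    λ (F∈Δ , max) → sym (max D∈Δ (proj₁ (to F∈Δ)))
    where
    D∈Δ : Face Δ D
    D∈Δ = from (id , free)

  link-relative : ∀ {D S v} Δ → Face Δ ≐ RelativeFace D S → v ∈ D →
    Face (link Δ v) ≐ RelativeFace (D - v) (S ∪ ⁅ v ⁆)
  link-relative {D} {S} {v} Δ (to , from) v∈D = to′ , from′
    where
    shift : ∀ F → (F ∪ ⁅ v ⁆) ∪ S ≡ F ∪ (S ∪ ⁅ v ⁆)
    shift F = trans (∪-swapʳ F ⁅ v ⁆ S) (∪-assoc F S ⁅ v ⁆)
    to′ : ∀ {F} → Face (link Δ v) F → RelativeFace (D - v) (S ∪ ⁅ v ⁆) F
    to′ {F} (F∈Δ , v∉F , F∪v∈Δ) =
      p⊆q∧x∉p⇒p⊆q-x (proj₁ (to F∈Δ)) v∉F ,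
      subst PathFree (shift F) (proj₂ (to F∪v∈Δ))
    from′ : ∀ {F} → RelativeFace (D - v) (S ∪ ⁅ v ⁆) F → Face (link Δ v) F
    from′ {F} (F⊆D-v , free) =
      closed Δ (x∈p∪q⁺ ∘ inj₁) F∪v∈Δ , x∉p-x D v ∘ F⊆D-v , F∪v∈Δ
      where
      F∪v∈Δ : Face Δ (F ∪ ⁅ v ⁆)
      F∪v∈Δ = from
        ( [ p─q⊆p D _ ∘ F⊆D-v , x∈p⇒⁅x⁆⊆p v∈D ]′ ∘ x∈p∪q⁻ F _
        , subst PathFree (sym (shift F)) free )

  deletion-relative : ∀ {D S v} Δ → Face Δ ≐ RelativeFace D S →
    Face (deletion Δ v) ≐ RelativeFace (D - v) S
  deletion-relative {D} {v = v} Δ (to , from) =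
    (λ {F} (F∈Δ , v∉F) →
       p⊆q∧x∉p⇒p⊆q-x (proj₁ (to F∈Δ)) v∉F ,
       proj₂ (to F∈Δ)) ,
    (λ (F⊆D-v , free) → from (p─q⊆p D _ ∘ F⊆D-v , free) , x∉p-x D v ∘ F⊆D-v)

  -- No face contains such a `v`, so it can be discarded from `D` without changing the complex.
  non-vertex-relative : ∀ {D S v} Δ → Face Δ ≐ RelativeFace D S → ¬ PathFree (S ∪ ⁅ v ⁆) →
    Face Δ ≐ RelativeFace (D - v) S
  non-vertex-relative {D} {S} {v} Δ (to , from) ¬free =
    (λ {F} F∈Δ → let F⊆D , free = to F∈Δ in
       p⊆q∧x∉p⇒p⊆q-x F⊆D (λ v∈F → ¬free (pathFree-⊆
         ([ x∈p∪q⁺ ∘ inj₂ , x∈p∪q⁺ ∘ inj₁ ∘ x∈p⇒⁅x⁆⊆p v∈F ]′ ∘ x∈p∪q⁻ S _) free)) ,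
       free) ,
    (λ (F⊆D-v , free) → from (p─q⊆p D _ ∘ F⊆D-v , free))

  -- If a face containing `v` extended `F`, exchanging `v` for `w` would give a larger face that
  -- avoids `v`, against maximality of `F` in the deletion.
  exchangeable⇒shedding : ∀ {D S v} Δ → Face Δ ≐ RelativeFace D S → v ∉ S →
    Exchangeable (D ∪ S) S v → ∀ F → IsFacet (deletion Δ v) F → IsFacet Δ F
  exchangeable⇒shedding {D} {S} {v} Δ (to , from) v∉S exchange F ((F∈Δ , v∉F) , max) =
    F∈Δ , max′
    where
    F⊆D = proj₁ (to F∈Δ)

    v∉F∪S : v ∉ F ∪ S
    v∉F∪S = [ v∉F , v∉S ]′ ∘ x∈p∪q⁻ F S

    ¬addable : ¬ PathFree ((F ∪ S) ∪ ⁅ v ⁆)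
    ¬addable free
      with w , w∈H , w∉K , w≢v , free′ ← exchange (x∈p∪q⁺ ∘ inj₂) (∪-monoˡ S F⊆D) v∉F∪S free
      = w∉K (x∈p∪q⁺ (inj₁ (subst (w ∈_) (sym F≡F∪w) w∈F∪w)))
      where
      w∈F∪w : w ∈ F ∪ ⁅ w ⁆
      w∈F∪w = x∈p∪q⁺ {p = F} (inj₂ (x∈⁅x⁆ w))
      -- `w` lies outside `S` because the exchange is made for `F ∪ S`.
      w∈D : w ∈ D
      w∈D = x∈p∪q∧x∉q⇒x∈p w∈H (w∉K ∘ x∈p∪q⁺ ∘ inj₂)
      F≡F∪w : F ≡ F ∪ ⁅ w ⁆
      F≡F∪w = max
        ( from ( [ F⊆D , x∈p⇒⁅x⁆⊆p w∈D ]′ ∘ x∈p∪q⁻ F _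
               , subst PathFree (∪-swapʳ F S ⁅ w ⁆) free′ )
        , [ v∉F , (λ v∈w → w≢v (sym (x∈⁅y⁆⇒x≡y w v∈w))) ]′ ∘ x∈p∪q⁻ F _ )
        (x∈p∪q⁺ ∘ inj₁)

    max′ : ∀ {H} → Face Δ H → F ⊆ H → F ≡ H
    max′ {H} H∈Δ F⊆H with v ∈? H
    ... | no v∉H  = max (H∈Δ , v∉H) F⊆H
    ... | yes v∈H = ⊥-elim (¬addable (pathFree-⊆ F∪S∪v⊆H∪S (proj₂ (to H∈Δ))))
      where
      F∪S∪v⊆H∪S : (F ∪ S) ∪ ⁅ v ⁆ ⊆ H ∪ S
      F∪S∪v⊆H∪S = [ ∪-monoˡ S F⊆H , x∈p∪q⁺ ∘ inj₁ ∘ x∈p⇒⁅x⁆⊆p v∈H ]′ ∘ x∈p∪q⁻ (F ∪ S) _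

  -- The induction on available vertices.

  -- Either `D` can be shrunk at once, or the hypothesis of `exchangeable` holds.
  nonVertex? : ∀ D {S} → PathFree S →
    (∃ λ v → v ∈ D × ¬ PathFree (S ∪ ⁅ v ⁆)) ⊎ (∀ {v} → v ∈ D ∪ S → PathFree (S ∪ ⁅ v ⁆))
  nonVertex? D {S} S-free with any? (λ v → v ∈? D ×-dec ¬? (pathFree? (S ∪ ⁅ v ⁆)))
  ... | yes nonVertex = inj₁ nonVertex
  ... | no ¬nonVertex = inj₂ S∪v-free
    where
    S∪v-free : ∀ {v} → v ∈ D ∪ S → PathFree (S ∪ ⁅ v ⁆)
    S∪v-free {v} v∈D∪S with x∈p∪q⁻ D S v∈D∪S
    ... | inj₁ v∈D = decidable-stable (pathFree? _) λ ¬free → ¬nonVertex (v , v∈D , ¬free)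
    ... | inj₂ v∈S = pathFree-⊆ ([ id , x∈p⇒⁅x⁆⊆p v∈S ]′ ∘ x∈p∪q⁻ S _) S-free

  -- `Δ` is an arbitrary complex with the right faces because links and deletions are brought to the
  -- relative form only up to `≐`.
  relative-vertexDecomposable : ∀ {D} → Acc _⊂_ D → ∀ {S} Δ → Face Δ ≐ RelativeFace D S →
    VertexDecomposable Δ
  relative-vertexDecomposable {D} (acc rec) {S} Δ Δ≐@(to , from) with path₃? S
  ... | inj₁ path = void λ F F∈Δ →
        path₃-¬pathFree path (pathFree-⊆ (x∈p∪q⁺ ∘ inj₂) (proj₂ (to F∈Δ)))
  ... | inj₂ S-free with nonVertex? D S-free
  ...   | inj₁ (v , v∈D , ¬free) =
          relative-vertexDecomposable (rec (x∈p⇒p-x⊂p v∈D)) Δ (non-vertex-relative Δ Δ≐ ¬free)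
  ...   | inj₂ S∪v-free with path₃? (D ∪ S)
  ...     | inj₂ free = simplex (simplex-relative Δ Δ≐ free)
  ...     | inj₁ path
            with v , v∈H , v∉S , exchange ← exchangeable S∪v-free path
            = decompose v
                (from (x∈p⇒⁅x⁆⊆p (x∈p∪q∧x∉q⇒x∈p v∈H v∉S) ,
                       subst PathFree (∪-comm S ⁅ v ⁆) (S∪v-free v∈H)))
                (relative-vertexDecomposable (rec (x∈p⇒p-x⊂p (x∈p∪q∧x∉q⇒x∈p v∈H v∉S)))
                  (link Δ v) (link-relative Δ Δ≐ (x∈p∪q∧x∉q⇒x∈p v∈H v∉S)))
                (relative-vertexDecomposable (rec (x∈p⇒p-x⊂p (x∈p∪q∧x∉q⇒x∈p v∈H v∉S)))
                  (deletion Δ v) (deletion-relative Δ Δ≐))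
                (exchangeable⇒shedding Δ Δ≐ v∉S exchange)

  -- The start of the induction: every vertex is available and none is fixed.
  pathFreeComplex-relative : Face (pathFreeComplex 3 G) ≐ RelativeFace ⊤ Subset.⊥
  pathFreeComplex-relative = to , from
    where
    to : ∀ {F} → Face (pathFreeComplex 3 G) F → RelativeFace ⊤ Subset.⊥ F
    to {F} ¬path = (λ _ → ∈⊤) , λ a∈ b∈ c∈ a~b c~b → decidable-stable (_ ≟ _) λ a≢c →
      ¬path (_ , refl ,
        ( ((adj⇒≢ a~b ∷ a≢c ∷ []) ∷ (adj⇒≢ (adj-sym c~b) ∷ []) ∷ [] ∷ [])
        , a~b ∷ adj-sym c~b ∷ [-] ) ,
        drop-⊥ a∈ ∷ drop-⊥ b∈ ∷ drop-⊥ c∈ ∷ [])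
      where
      drop-⊥ : ∀ {u} → u ∈ F ∪ Subset.⊥ → u ∈ F
      drop-⊥ = subst (_ ∈_) (∪-identityʳ F)
    from : ∀ {F} → RelativeFace ⊤ Subset.⊥ F → Face (pathFreeComplex 3 G) F
    from (_ , free) (a ∷ b ∷ c ∷ [] , refl ,
      (((_ ∷ a≢c ∷ _) ∷ _) , a~b ∷ b~c ∷ _) , a∈F ∷ b∈F ∷ c∈F ∷ []) =
      a≢c (free (x∈p∪q⁺ (inj₁ a∈F)) (x∈p∪q⁺ (inj₁ b∈F)) (x∈p∪q⁺ (inj₁ c∈F)) a~b (adj-sym b~c))

mainTheorem4 : ∀ (n : ℕ) (T : Graph n) → IsTree T →
    VertexDecomposable (pathFreeComplex 3 T)
mainTheorem4 n T tree =
  relative-vertexDecomposable (⊂-wellFounded ⊤) (pathFreeComplex 3 T) pathFreeComplex-relative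
  where open Forest T (IsTree.uniquePath tree)
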